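{- Let $\pi = 1 \oplus \rho$ be a permutation of length $n \ge 4$ of the form $1\,n\cdots 2$, i.e. $\pi(1)=1$, $\pi(2)=n$ and $\pi(n)=2$, and suppose $\rho$ has no increasing bond. Then the class $\operatorname{Av}(\pi)$ is not deflatable.
   Context: A permutation $\alpha$ is contained in $\beta$ if $\beta$ has a subsequence in the same relative order as $\alpha$; a class is a set of permutations closed under taking contained permutations; $\operatorname{Av}(\pi)$ is the class of permutations not containing $\pi$. $1\oplus\rho$ denotes a new minimum entry placed before a copy of $\rho$. A bond of a permutation is a pair of entries in adjacent positions whose values differ by $1$; it is increasing if they form the pattern $12$. An interval of a permutation is a set of entries whose positions and values each form a set of consecutive integers, the whole permutation not counting as an interval; a permutation is simple if all its intervals are single entries (so $1$, $12$, $21$ are simple). A class $\mathcal{C}$ is deflatable if there is a proper subclass $\mathcal{D}\subsetneq\mathcal{C}$ with $\mathcal{C}\subseteq\langle\mathcal{D}\rangle$, where the substitution closure $\langle\mathcal{D}\rangle$ is the largest class whose simple permutations are exactly those of $\mathcal{D}$; equivalently, $\mathcal{C}$ is not deflatable if and only if every permutation in $\mathcal{C}$ is contained in some simple permutation belonging to $\mathcal{C}$. -}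

module Defs where

open import Data.Nat using (ℕ; zero; suc; _≤_; _<_; _≤?_; _<?_)
open import Data.Fin using (Fin; zero; suc; toℕ; fromℕ<)
open import Data.Fin.Properties using (suc-injective)
open import Data.Product using (Σ; ∃; _×_; _,_)
open import Data.Sum using (_⊎_)
open import Data.Empty using (⊥)
open import Function using (_⇔_)
open import Relation.Nullary using (¬_; yes; no)
open import Relation.Binary.PropositionalEquality using (_≡_; refl; cong)
open import Level using (Level) renaming (suc to lsuc; zero to lzero)

-- A permutation of length len: an injective map Fin len → Fin len
-- (position i ↦ value; both 0-indexed internally).
record Perm : Set where
  constructor perm
  field
    len  : ℕ
    fun  : Fin len → Fin len
    inj  : ∀ i j → fun i ≡ fun j → i ≡ j
open Perm public

-- 1-indexed access: at σ k = σ(k) (values 1..len), 0 when k is out of range.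
at : Perm → ℕ → ℕ
at σ zero = zero
at σ (suc j) with j <? len σ
... | yes p = suc (toℕ (fun σ (fromℕ< p)))
... | no _  = zero

_≼_ : Perm → Perm → Set
α ≼ β = Σ (Fin (len α) → Fin (len β)) λ e →
          (∀ i j → toℕ i < toℕ j → toℕ (e i) < toℕ (e j)) ×
          (∀ i j → (toℕ (fun α i) < toℕ (fun α j)) ⇔ (toℕ (fun β (e i)) < toℕ (fun β (e j))))

IsClass : (Perm → Set) → Set
IsClass C = ∀ σ τ → σ ≼ τ → C τ → C σ

Av : Perm → Perm → Set
Av π σ = ¬ (π ≼ σ)

oplus1-fun : (ρ : Perm) → Fin (suc (len ρ)) → Fin (suc (len ρ))
oplus1-fun ρ zero    = zero
oplus1-fun ρ (suc i) = suc (fun ρ i)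

oplus1-inj : (ρ : Perm) → ∀ i j → oplus1-fun ρ i ≡ oplus1-fun ρ j → i ≡ j
oplus1-inj ρ zero    zero    _ = refl
oplus1-inj ρ zero    (suc j) ()
oplus1-inj ρ (suc i) zero    ()
oplus1-inj ρ (suc i) (suc j) e = cong suc (inj ρ i j (suc-injective e))

1⊕_ : Perm → Perm
1⊕ ρ = perm (suc (len ρ)) (oplus1-fun ρ) (oplus1-inj ρ)

HasIncreasingBond : Perm → Set
HasIncreasingBond σ = ∃ λ k → (1 ≤ k) × (suc k ≤ len σ) × (at σ (suc k) ≡ suc (at σ k))

-- The entries at positions a..b (0-indexed, a ≤ b) form an interval when their
-- values also form a set of consecutive integers: any entry whose value lies
-- between two values of the block lies in the block.
IsIntervalSeg : (σ : Perm) → ℕ → ℕ → Set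
IsIntervalSeg σ a b = (a ≤ b) × (b < len σ) ×
  (∀ i j k → a ≤ toℕ i → toℕ i ≤ b → a ≤ toℕ j → toℕ j ≤ b →
     toℕ (fun σ i) ≤ toℕ (fun σ k) → toℕ (fun σ k) ≤ toℕ (fun σ j) →
     (a ≤ toℕ k) × (toℕ k ≤ b))

IsSimple : Perm → Set
IsSimple σ = ∀ a b → IsIntervalSeg σ a b →
  (a ≡ b) ⊎ ((a ≡ 0) × (suc b ≡ len σ))

-- Substitution closure ⟨D⟩: the largest class whose simple permutations are
-- those of D, i.e. the permutations all of whose simple subpermutations lie in D.
SubstClosure : (Perm → Set) → Perm → Set
SubstClosure D σ = ∀ τ → IsSimple τ → τ ≼ σ → D τ

Deflatable : (Perm → Set) → Set₁
Deflatable C = Σ (Perm → Set) λ D →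
  IsClass D × (∀ σ → D σ → C σ) × (∃ λ σ → C σ × ¬ D σ) ×
  (∀ σ → C σ → SubstClosure D σ)

{-# OPTIONS --safe #-}
module Submission where

-- A class is not deflatable as soon as each of its members σ is contained in a
-- simple member. Starting from σ ⊕ 1, one entry at a time is inserted.
-- First, while a proper interval J with at least two entries starts with a
-- left-to-right minimum, cut it by an entry b placed just before its last entry
-- and next in value to the lowest entry q above and to the right of J: just below
-- q if some entry outside J has a value between J and q, just above q otherwise.
-- If b is the last entry of a copy of π, then q can replace it; the remaining
-- copies are excluded by π = 1 n ⋯ 2 with n ≥ 4.
-- Afterwards no proper nontrivial interval contains a left-to-right minimum, and
-- this persists when adjacent entries that are not left-to-right minima are
-- separated by a new one just below the minimum of the preceding entries. When
-- every two adjacent entries include a left-to-right minimum, the permutation is simple.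

open import Defs
open import Data.Nat using (ℕ; zero; suc; _+_; _*_; _∸_; _≤_; _<_; z≤n; s≤s; z<s; _≤?_; _<?_)
open import Data.Nat.Properties
open import Data.Fin using (Fin; zero; suc; toℕ; fromℕ; fromℕ<)
open import Data.Fin.Properties as Fin using (toℕ<n; toℕ-injective; toℕ-fromℕ; toℕ-fromℕ<; fromℕ<-toℕ)
open import Data.Product as Product using (Σ; ∃; _×_; _,_; proj₁; proj₂)
open import Data.Sum as Sum using (_⊎_; inj₁; inj₂; [_,_]′)
open import Data.Empty using (⊥; ⊥-elim)
open import Data.Unit using (⊤; tt)
open import Function using (_∘_; mk⇔)
open import Function.Bundles using (Equivalence)
open import Function.Definitions using (Injective)
open import Relation.Binary using (tri<; tri≈; tri>)
open import Relation.Binary.PropositionalEquality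
open import Relation.Nullary using (¬_; Dec; yes; no; contradiction; ¬?; _×-dec_; _→-dec_)
open import Relation.Nullary.Decidable using (decidable-stable)
open import Relation.Unary using (Decidable)

-- Copies, intervals and left-to-right minima of injective sequences

-- A permutation is worked with as an injective f : ℕ → ℕ of which only the
-- entries at positions below N count; only the relative order of values matters.

-- One direction of the order condition suffices: the values of `α` are distinct, so the converse
-- follows by trichotomy.
Copy : Perm → ℕ → (ℕ → ℕ) → Set
Copy α N f = Σ (Fin (len α) → ℕ) λ e →
  (∀ i → e i < N) ×
  (∀ i j → toℕ i < toℕ j → e i < e j) ×
  (∀ i j → toℕ (fun α i) < toℕ (fun α j) → f (e i) < f (e j))

Interval : ℕ → (ℕ → ℕ) → ℕ → ℕ → Set
Interval N f a c =
  ∀ {i} → i < suc c → ∀ {j} → j < suc c → ∀ {k} → k < N →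
  a ≤ i → a ≤ j → f i < f k → f k < f j → a ≤ k × k ≤ c

interval? : ∀ N f a c → Dec (Interval N f a c)
interval? N f a c =
  allUpTo? (λ i → allUpTo? (λ j → allUpTo? (λ k →
    (a ≤? i) →-dec (a ≤? j) →-dec (f i <? f k) →-dec (f k <? f j) →-dec
    ((a ≤? k) ×-dec (k ≤? c))) N) (suc c)) (suc c)

LRMin : (ℕ → ℕ) → ℕ → Set
LRMin f a = ∀ {j} → j < a → f a < f j

module _ {f : ℕ → ℕ} (f-inj : Injective _≡_ _≡_ f) where

  ≤∧≢⇒f< : ∀ {i j} → f i ≤ f j → i ≢ j → f i < f j
  ≤∧≢⇒f< fi≤fj i≢j = ≤∧≢⇒< fi≤fj (i≢j ∘ f-inj)

  lrMin-dec : ∀ a → LRMin f a ⊎ (∃ λ j → j < a × f j < f a)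
  lrMin-dec a with anyUpTo? (λ j → f j <? f a) a
  ... | yes lower = inj₂ lower
  ... | no ¬lower = inj₁ λ {j} j<a →
          ≤∧≢⇒f< (≮⇒≥ λ fj<fa → ¬lower (j , j<a , fj<fa)) (>⇒≢ j<a)

argmin : ∀ (f : ℕ → ℕ) {P : ℕ → Set} → Decidable P → ∀ N → (∃ λ n → n < N × P n) →
         ∃ λ q → q < N × P q × (∀ {k} → k < N → P k → f q ≤ f k)
argmin f P? (suc N) (n , n<1+N , Pn) with anyUpTo? P? N | P? N
... | no none | no ¬PN with m<1+n⇒m<n∨m≡n n<1+N
...   | inj₁ n<N  = ⊥-elim (none (n , n<N , Pn))
...   | inj₂ refl = ⊥-elim (¬PN Pn)
argmin f {P} P? (suc N) _ | no none | yes PN = N , ≤-refl , PN , least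
  where
  least : ∀ {k} → k < suc N → P k → f N ≤ f k
  least k<1+N Pk with m<1+n⇒m<n∨m≡n k<1+N
  ... | inj₁ k<N  = ⊥-elim (none (_ , k<N , Pk))
  ... | inj₂ refl = ≤-refl
argmin f {P} P? (suc N) _ | yes some | PN? with argmin f P? N some
... | q , q<N , Pq , q-least with PN? | f q ≤? f N
...   | yes PN | no fq≰fN = N , ≤-refl , PN , least
  where
  least : ∀ {k} → k < suc N → P k → f N ≤ f k
  least k<1+N Pk with m<1+n⇒m<n∨m≡n k<1+N
  ... | inj₁ k<N  = ≤-trans (<⇒≤ (≰⇒> fq≰fN)) (q-least k<N Pk)
  ... | inj₂ refl = ≤-refl
...   | yes PN | yes fq≤fN = q , m<n⇒m<1+n q<N , Pq , least
  where
  least : ∀ {k} → k < suc N → P k → f q ≤ f k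
  least k<1+N Pk with m<1+n⇒m<n∨m≡n k<1+N
  ... | inj₁ k<N  = q-least k<N Pk
  ... | inj₂ refl = fq≤fN
...   | no ¬PN | _ = q , m<n⇒m<1+n q<N , Pq , least
  where
  least : ∀ {k} → k < suc N → P k → f q ≤ f k
  least k<1+N Pk with m<1+n⇒m<n∨m≡n k<1+N
  ... | inj₁ k<N  = q-least k<N Pk
  ... | inj₂ refl = ⊥-elim (¬PN Pk)

-- Inserting one entry

-- The increasing enumeration of the positions other than `p`, like `punchIn` on `Fin`.
up : ℕ → ℕ → ℕ
up zero    j       = suc j
up (suc p) zero    = zero
up (suc p) (suc j) = suc (up p j)

data View (p : ℕ) : ℕ → Set where
  new : View p p
  old : ∀ j → View p (up p j)

view : ∀ p j → View p j
view zero    zero    = new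
view zero    (suc j) = old j
view (suc p) zero    = old zero
view (suc p) (suc j) with view p j
... | new   = new
... | old i = old (suc i)

up-mono-≤ : ∀ p {i j} → i ≤ j → up p i ≤ up p j
up-mono-≤ zero    i≤j       = s≤s i≤j
up-mono-≤ (suc p) z≤n       = z≤n
up-mono-≤ (suc p) (s≤s i≤j) = s≤s (up-mono-≤ p i≤j)

up-cancel-≤ : ∀ p {i j} → up p i ≤ up p j → i ≤ j
up-cancel-≤ zero                      (s≤s i≤j) = i≤j
up-cancel-≤ (suc p) {zero}            _         = z≤n
up-cancel-≤ (suc p) {suc i} {suc j}   (s≤s le)  = s≤s (up-cancel-≤ p le)

up-mono-< : ∀ p {i j} → i < j → up p i < up p j
up-mono-< p i<j = ≰⇒> λ le → <⇒≱ i<j (up-cancel-≤ p le)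

up-cancel-< : ∀ p {i j} → up p i < up p j → i < j
up-cancel-< p lt = ≰⇒> λ j≤i → <⇒≱ lt (up-mono-≤ p j≤i)

up-below : ∀ {p j} → j < p → up p j ≡ j
up-below {suc p} {zero}  _         = refl
up-below {suc p} {suc j} (s≤s j<p) = cong suc (up-below j<p)

up-above : ∀ {p j} → p ≤ j → up p j ≡ suc j
up-above z≤n       = refl
up-above (s≤s p≤j) = cong suc (up-above p≤j)

up<⇒< : ∀ {p j} → up p j < p → j < p
up<⇒< {p} {j} lt = ≰⇒> λ p≤j →
  <⇒≱ (subst (_< p) (up-above p≤j) lt) (m≤n⇒m≤1+n p≤j)

<up⇒≤ : ∀ {p j} → p < up p j → p ≤ j
<up⇒≤ {p} lt = ≮⇒≥ λ j<p → <-asym j<p (subst (p <_) (up-below j<p) lt)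

up≤⇒< : ∀ {p j} → up p j ≤ p → j < p
up≤⇒< {p} {j} le = ≰⇒> λ p≤j →
  <⇒≱ (s≤s p≤j) (subst (_≤ p) (up-above p≤j) le)

up-< : ∀ p {j N} → j < N → up p j < suc N
up-< p {j} {N} j<N with j <? p
... | yes j<p = subst (_< suc N) (sym (up-below j<p)) (m<n⇒m<1+n j<N)
... | no  j≮p = subst (_< suc N) (sym (up-above (≮⇒≥ j≮p))) (s≤s j<N)

up<suc⇒< : ∀ {p j N} → p ≤ N → up p j < suc N → j < N
up<suc⇒< {p} {j} {N} p≤N lt with j <? p
... | yes j<p = ≤-trans j<p p≤N
... | no  j≮p = ≤-pred (subst (_< suc N) (up-above (≮⇒≥ j≮p)) lt)

-- The new entry sits at position p; its value 2u lies just below the old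
-- entries of value ≥ u, whose values y become 2y + 1.
ins : ℕ → ℕ → (ℕ → ℕ) → ℕ → ℕ
ins zero    u f zero    = 2 * u
ins zero    u f (suc j) = suc (2 * f j)
ins (suc p) u f zero    = suc (2 * f zero)
ins (suc p) u f (suc j) = ins p u (f ∘ suc) j

ins-new : ∀ p u f → ins p u f p ≡ 2 * u
ins-new zero    u f = refl
ins-new (suc p) u f = ins-new p u (f ∘ suc)

ins-old : ∀ p u f j → ins p u f (up p j) ≡ suc (2 * f j)
ins-old zero    u f j       = refl
ins-old (suc p) u f zero    = refl
ins-old (suc p) u f (suc j) = ins-old p u (f ∘ suc) j

module _ (p u : ℕ) (f : ℕ → ℕ) where

  private f′ = ins p u f

  old<old : ∀ {i j} → f i < f j → f′ (up p i) < f′ (up p j)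
  old<old {i} {j} lt rewrite ins-old p u f i | ins-old p u f j = s≤s (*-monoʳ-< 2 lt)

  old<old⁻ : ∀ {i j} → f′ (up p i) < f′ (up p j) → f i < f j
  old<old⁻ {i} {j} lt rewrite ins-old p u f i | ins-old p u f j = *-cancelˡ-< 2 _ _ (≤-pred lt)

  new<old : ∀ {j} → u ≤ f j → f′ p < f′ (up p j)
  new<old {j} le rewrite ins-new p u f | ins-old p u f j = s≤s (*-monoʳ-≤ 2 le)

  old<new : ∀ {j} → f j < u → f′ (up p j) < f′ p
  old<new {j} lt rewrite ins-new p u f | ins-old p u f j =
    subst (_≤ 2 * u) (*-suc 2 (f j)) (*-monoʳ-≤ 2 lt)

  new<old⁻ : ∀ {j} → f′ p < f′ (up p j) → u ≤ f j
  new<old⁻ lt = ≮⇒≥ λ fj<u → <-asym lt (old<new fj<u)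

  old<new⁻ : ∀ {j} → f′ (up p j) < f′ p → f j < u
  old<new⁻ lt = ≰⇒> λ u≤fj → <-asym lt (new<old u≤fj)

  new≢old : ∀ {j} → f′ p ≢ f′ (up p j)
  new≢old {j} eq with f j <? u
  ... | yes fj<u = >⇒≢ (old<new fj<u) eq
  ... | no  fj≮u = <⇒≢ (new<old (≮⇒≥ fj≮u)) eq

  ins-injective : Injective _≡_ _≡_ f → Injective _≡_ _≡_ f′
  ins-injective f-inj {i} {j} eq with view p i | view p j
  ... | new   | new   = refl
  ... | new   | old b = contradiction eq new≢old
  ... | old a | new   = contradiction (sym eq) new≢old
  ... | old a | old b rewrite ins-old p u f a | ins-old p u f b =
    cong (up p) (f-inj (*-cancelˡ-≡ _ _ 2 (suc-injective eq)))

  copy-old : ∀ {α N} → Copy α N f → Copy α (suc N) f′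
  copy-old (e , e< , e-mono , e-ord) =
    up p ∘ e , up-< p ∘ e< ,
    (λ i j lt → up-mono-< p (e-mono i j lt)) , (λ i j lt → old<old (e-ord i j lt))

  lrMin-old : ∀ {a} → LRMin f′ (up p a) → LRMin f a
  lrMin-old lr j<a = old<old⁻ (lr (up-mono-< p j<a))

  -- An end `a′` or `c′` may be the new entry, hence need not be an image under `up p`; it is enough
  -- that the old positions between the two ends are those from `a` to `c`.
  interval-old : ∀ {N a c a′ c′} →
    (∀ {j} → a ≤ j → a′ ≤ up p j) → (∀ {j} → a′ ≤ up p j → a ≤ j) →
    (∀ {j} → j ≤ c → up p j ≤ c′) → (∀ {j} → up p j ≤ c′ → j ≤ c) →
    Interval (suc N) f′ a′ c′ → Interval N f a c
  interval-old a⇒ a⇐ c⇒ c⇐ int i≤c j≤c k<N a≤i a≤j lt₁ lt₂ =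
    let a′≤k , k≤c′ = int (s≤s (c⇒ (≤-pred i≤c))) (s≤s (c⇒ (≤-pred j≤c))) (up-< p k<N)
                          (a⇒ a≤i) (a⇒ a≤j) (old<old lt₁) (old<old lt₂)
    in a⇐ a′≤k , c⇐ k≤c′

-- Copies through the inserted entry

down : ℕ → ℕ → ℕ
down p j with view p j
-- Junk value, excluded in `up-down`.
... | new   = zero
... | old i = i

up-down : ∀ p j → j ≢ p → up p (down p j) ≡ j
up-down p j j≢p with view p j
... | new   = contradiction refl j≢p
... | old i = refl

-- What remains of a copy of α when its entry k₀ is the inserted entry;
-- the value of place at k₀ is junk.
record NearCopy (α : Perm) (N p u : ℕ) (f : ℕ → ℕ) : Set where
  field
    k₀    : Fin (len α)
    place : Fin (len α) → ℕ
    bound : ∀ {i} → i ≢ k₀ → place i < N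
    mono  : ∀ {i j} → i ≢ k₀ → j ≢ k₀ → toℕ i < toℕ j → place i < place j
    ord   : ∀ {i j} → i ≢ k₀ → j ≢ k₀ → toℕ (fun α i) < toℕ (fun α j) → f (place i) < f (place j)
    left  : ∀ {i} → toℕ i < toℕ k₀ → place i < p
    right : ∀ {i} → toℕ k₀ < toℕ i → p ≤ place i
    below : ∀ {i} → toℕ (fun α i) < toℕ (fun α k₀) → f (place i) < u
    above : ∀ {i} → toℕ (fun α k₀) < toℕ (fun α i) → u ≤ f (place i)

module _ {α : Perm} {N p u : ℕ} {f : ℕ → ℕ} where

  -- A copy that misses position `p` transfers to `f` along `down p`; one that uses it becomes a
  -- `NearCopy` when that entry is removed.
  legal : p ≤ N → ¬ Copy α N f → ¬ NearCopy α N p u f → ¬ Copy α (suc N) (ins p u f)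
  legal p≤N ¬copy ¬near (e , e< , e-mono , e-ord) with Fin.any? (λ k → e k ≟ p)
  ... | no ¬hit = ¬copy
    ( down p ∘ e
    , (λ i → up<suc⇒< p≤N (subst (_< suc N) (sym (ud i)) (e< i)))
    , (λ i j lt → up-cancel-< p (subst₂ _<_ (sym (ud i)) (sym (ud j)) (e-mono i j lt)))
    , (λ i j lt → old<old⁻ p u f
        (subst₂ (λ x y → ins p u f x < ins p u f y) (sym (ud i)) (sym (ud j)) (e-ord i j lt))) )
    where
    ud : ∀ i → up p (down p (e i)) ≡ e i
    ud i = up-down p (e i) λ eq → ¬hit (i , eq)
  ... | yes (k₀ , refl) = ¬near record
    { k₀ = k₀
    ; place = down p ∘ e
    ; bound = λ {i} i≢ → up<suc⇒< p≤N (subst (_< suc N) (sym (ud i≢)) (e< i))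
    ; mono = λ {i} {j} i≢ j≢ lt →
        up-cancel-< p (subst₂ _<_ (sym (ud i≢)) (sym (ud j≢)) (e-mono i j lt))
    ; ord = λ {i} {j} i≢ j≢ lt → old<old⁻ p u f
        (subst₂ (λ x y → ins p u f x < ins p u f y) (sym (ud i≢)) (sym (ud j≢)) (e-ord i j lt))
    ; left = λ {i} lt → up<⇒<
        (subst (_< p) (sym (ud λ { refl → <-irrefl refl lt })) (e-mono i k₀ lt))
    ; right = λ {i} lt → <up⇒≤
        (subst (p <_) (sym (ud λ { refl → <-irrefl refl lt })) (e-mono k₀ i lt))
    ; below = λ {i} lt → old<new⁻ p u f
        (subst (λ x → ins p u f x < ins p u f p) (sym (ud λ { refl → <-irrefl refl lt })) (e-ord i k₀ lt))
    ; above = λ {i} lt → new<old⁻ p u f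
        (subst (λ x → ins p u f p < ins p u f x) (sym (ud λ { refl → <-irrefl refl lt })) (e-ord k₀ i lt))
    }
    where
    ud : ∀ {i} → i ≢ k₀ → up p (down p (e i)) ≡ e i
    ud {i} i≢k₀ = up-down p (e i) distinct
      where
      distinct : e i ≢ e k₀
      distinct eq with <-cmp (toℕ i) (toℕ k₀)
      ... | tri< lt _ _ = <⇒≢ (e-mono i k₀ lt) eq
      ... | tri≈ _ ≡ _ = i≢k₀ (toℕ-injective ≡)
      ... | tri> _ _ gt = >⇒≢ (e-mono k₀ i gt) eq

  module _ (near : NearCopy α N p u f) where
    open NearCopy near

    replace : ∀ {z} → z < N →
      (∀ {i} → toℕ i < toℕ k₀ → place i < z) →
      (∀ {i} → toℕ k₀ < toℕ i → z < place i) →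
      (∀ {i} → toℕ (fun α i) < toℕ (fun α k₀) → f (place i) < f z) →
      (∀ {i} → toℕ (fun α k₀) < toℕ (fun α i) → f z < f (place i)) →
      Copy α N f
    replace {z} z<N l r b a = e , e< , e-mono , e-ord
      where
      e : Fin (len α) → ℕ
      e i with i Fin.≟ k₀
      ... | yes _ = z
      ... | no _  = place i

      e< : ∀ i → e i < N
      e< i with i Fin.≟ k₀
      ... | yes _ = z<N
      ... | no i≢ = bound i≢

      e-mono : ∀ i j → toℕ i < toℕ j → e i < e j
      e-mono i j lt with i Fin.≟ k₀ | j Fin.≟ k₀
      ... | yes refl | yes refl = contradiction lt (<-irrefl refl)
      ... | yes refl | no _     = r lt
      ... | no _     | yes refl = l lt
      ... | no i≢    | no j≢    = mono i≢ j≢ lt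

      e-ord : ∀ i j → toℕ (fun α i) < toℕ (fun α j) → f (e i) < f (e j)
      e-ord i j lt with i Fin.≟ k₀ | j Fin.≟ k₀
      ... | yes refl | yes refl = contradiction lt (<-irrefl refl)
      ... | yes refl | no _     = a lt
      ... | no _     | yes refl = b lt
      ... | no i≢    | no j≢    = ord i≢ j≢ lt

-- Legal insertions

-- `third` records n ≥ 4: some position lies strictly between those of n and 2. `last-next` says
-- that the final value is 2.
record Shape (π : Perm) : Set where
  field
    first second third last : Fin (len π)
    first<       : ∀ {i} → i ≢ first → toℕ first < toℕ i
    second<      : ∀ {i} → i ≢ first → i ≢ second → toℕ second < toℕ i
    second<third : toℕ second < toℕ third
    third<last   : toℕ third < toℕ last
    <last        : ∀ {i} → i ≢ last → toℕ i < toℕ last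
    first-least  : ∀ {i} → i ≢ first → toℕ (fun π first) < toℕ (fun π i)
    second-max   : ∀ {i} → i ≢ second → toℕ (fun π i) < toℕ (fun π second)
    last-next    : ∀ {i} → i ≢ first → i ≢ last → toℕ (fun π last) < toℕ (fun π i)

module _ {π : Perm} (shape : Shape π) {N : ℕ} {f : ℕ → ℕ} (f-inj : Injective _≡_ _≡_ f)
         (avoid : ¬ Copy π N f) where
  open Shape shape

  private
    ≢first : ∀ {i j : Fin (len π)} → toℕ i < toℕ j → j ≢ first
    ≢first {i} lt refl = <-asym lt (first< λ { refl → <-irrefl refl lt })

    ≢last : ∀ {i j : Fin (len π)} → toℕ i < toℕ j → i ≢ last
    ≢last {j = j} lt refl = <-asym lt (<last λ { refl → <-irrefl refl lt })

    value-≢first : ∀ {i j} → toℕ (fun π i) < toℕ (fun π j) → j ≢ first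
    value-≢first lt refl = <-asym lt (first-least λ { refl → <-irrefl refl lt })

    second≢first : second ≢ first
    second≢first eq = <-asym (first-least third≢first)
      (subst (λ i → toℕ (fun π third) < toℕ (fun π i)) eq
             (second-max λ { refl → <-irrefl refl second<third }))
      where
      third≢first : third ≢ first
      third≢first = ≢first second<third

  -- A new left-to-right minimum just below the prefix minimum m can only play
  -- the first entry of π, and m could play it instead.
  legal-min : ∀ {p m} → p ≤ N → m < p → (∀ {j} → j < p → f m ≤ f j) →
              ¬ Copy π (suc N) (ins p (f m) f)
  legal-min {p} {m} p≤N m<p m-least = legal p≤N avoid absurd
    where
    absurd : ¬ NearCopy π N p (f m) f
    absurd near with NearCopy.k₀ near Fin.≟ first
    ... | no k₀≢first = <⇒≱ (below (first-least k₀≢first)) (m-least (left (first< k₀≢first)))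
      where open NearCopy near
    ... | yes refl = avoid (replace near (<-≤-trans m<p p≤N)
            (λ lt → ⊥-elim (≢first lt refl))
            (λ lt → <-≤-trans m<p (right lt))
            (λ lt → ⊥-elim (value-≢first lt refl))
            (λ lt → ≤∧≢⇒f< f-inj (above lt)
                      (<⇒≢ (<-≤-trans m<p (right (first< (value-≢first lt)))))))
      where open NearCopy near

  -- Positions `i` to `c` form the interval J. Taking `f q` for `u` puts the new entry just below
  -- `q`, taking `suc (f q)` just above it.
  module _ {i c q u : ℕ} (i<c : i < c) (i-min : LRMin f i) (int : Interval N f i c)
           (c<q : c < q) (q<N : q < N) (fi<fq : f i < f q)
           (q-least : ∀ {k} → k < N → c < k × f i < f k → f q ≤ f k)
           (height : u ≡ f q ⊎
                     u ≡ suc (f q) × (∀ {t} → t < N → f i < f t → f t < f q → i ≤ t × t ≤ c))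
           where

    private
      c<N : c < N
      c<N = <-trans c<q q<N

      fq≤u : f q ≤ u
      fq≤u = [ ≤-reflexive ∘ sym , (λ (u≡ , _) → <⇒≤ (≤-reflexive (sym u≡))) ]′ height

      u≤1+fq : u ≤ suc (f q)
      u≤1+fq = [ (λ u≡ → ≤-trans (≤-reflexive u≡) (n≤1+n _)) , ≤-reflexive ∘ proj₁ ]′ height

      f<u⇒f<fq : ∀ {x} → f x < u → x ≢ q → f x < f q
      f<u⇒f<fq fx<u x≢q = ≤∧≢⇒f< f-inj (≤-pred (≤-trans fx<u u≤1+fq)) x≢q

    -- Otherwise the values of `i` and `x` would enclose that of `q` and force `q` into J, although
    -- `c < q`.
    inside⇒<fq : ∀ {x} → i ≤ x → x ≤ c → f x < f q
    inside⇒<fq {x} i≤x x≤c = ≰⇒> λ fq≤fx →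
      <⇒≱ c<q (proj₂ (int (s≤s (<⇒≤ i<c)) (s≤s x≤c) q<N ≤-refl i≤x fi<fq
                (≤∧≢⇒f< f-inj fq≤fx (>⇒≢ (≤-<-trans x≤c c<q)))))

    -- If the new entry is the first of a copy of `π`, then `i` can replace it; if it is the last,
    -- `q` can. In any other role the copy has its first entry `z` left of `c` and its last entry
    -- `l` at `c` or further right, with a value below `u`.
    legal-inner : ¬ Copy π (suc N) (ins c u f)
    legal-inner = legal (<⇒≤ c<N) avoid absurd
      where
      absurd : ¬ NearCopy π N c u f
      absurd near with NearCopy.k₀ near Fin.≟ first | NearCopy.k₀ near Fin.≟ last
      ... | yes refl | _ = avoid (replace near (<-trans i<c c<N)
              (λ lt → ⊥-elim (≢first lt refl))
              (λ lt → <-≤-trans i<c (right lt))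
              (λ lt → ⊥-elim (value-≢first lt refl))
              (λ lt → <-≤-trans fi<fq (≤-trans fq≤u (above lt))))
        where open NearCopy near
      ... | no _ | yes refl = avoid (replace near q<N
              (λ lt → <-trans (left lt) c<q)
              (λ lt → ⊥-elim (≢last lt refl))
              (λ lt → f<u⇒f<fq (below lt) (placed≢q λ { refl → <-irrefl refl lt }))
              (λ lt → ≤∧≢⇒f< f-inj (≤-trans fq≤u (above lt))
                        (≢-sym (placed≢q λ { refl → <-irrefl refl lt }))))
        where
        open NearCopy near
        placed≢q : ∀ {j} → j ≢ last → place j ≢ q
        placed≢q j≢last = <⇒≢ (<-trans (left (<last j≢last)) c<q)
      ... | no k₀≢first | no k₀≢last = crossing (i ≤? z)
        where
        open NearCopy near
        z l : ℕ
        z = place first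
        l = place last

        last≢first : last ≢ first
        last≢first = ≢first third<last

        z<c : z < c
        z<c = left (first< k₀≢first)

        c≤l : c ≤ l
        c≤l = right (<last k₀≢last)

        z<N : z < N
        z<N = bound (≢-sym k₀≢first)

        l<N : l < N
        l<N = bound (≢-sym k₀≢last)

        fz<fl : f z < f l
        fz<fl = ord (≢-sym k₀≢first) (≢-sym k₀≢last) (first-least last≢first)

        fl<u : f l < u
        fl<u = below (last-next k₀≢first k₀≢last)

        crossing : Dec (i ≤ z) → ⊥
        crossing (yes i≤z) with k₀ Fin.≟ second
        -- The maximum of the copy precedes the new entry and lies in J, hence below `f q`; yet it
        -- has to exceed the new entry.
        ... | no k₀≢second =
          <⇒≱ (inside⇒<fq (≤-trans i≤z (<⇒≤ z<place)) (<⇒≤ (left s<k₀)))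
               (≤-trans fq≤u (above (second-max k₀≢second)))
          where
          s<k₀ : toℕ second < toℕ k₀
          s<k₀ = second< k₀≢first k₀≢second
          z<place : z < place second
          z<place = mono (≢-sym k₀≢first) (≢-sym k₀≢second) (first< second≢first)
        -- Now `l` is right of J and above `i`, so `f q ≤ f l < f (place third)`, which leaves no
        -- room for the third entry below `u`.
        ... | yes refl = <⇒≱ (below (second-max third≢k₀)) (≤-trans u≤1+fq (≤-<-trans fq≤fl fl<f3))
          where
          third≢k₀ : third ≢ second
          third≢k₀ eq = <-irrefl (cong toℕ (sym eq)) second<third
          c<l : c < l
          c<l = ≤-<-trans (right second<third) (mono third≢k₀ (≢-sym k₀≢last) third<last)
          fi<fl : f i < f l
          fi<fl = ≰⇒> λ fl≤fi → <⇒≱ c<l (proj₂ (int (s≤s (<⇒≤ z<c)) (s≤s (<⇒≤ i<c)) l<N i≤z ≤-refl fz<fl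
                    (≤∧≢⇒f< f-inj fl≤fi (>⇒≢ (<-trans i<c c<l)))))
          fq≤fl : f q ≤ f l
          fq≤fl = q-least l<N (c<l , fi<fl)
          fl<f3 : f l < f (place third)
          fl<f3 = ord (≢-sym k₀≢last) third≢k₀ (last-next (≢first second<third) (≢last third<last))
        -- Here `z` is left of J and above `i`. If `l` is `c`, then `i` and `c` enclose the value of
        -- `z`. Otherwise `f q ≤ f l`, too high when `u` is `f q`; when `u` is `suc (f q)`, the
        -- value of `z` lies between those of `i` and `q`, so `z` would be in J.
        crossing (no i≰z) with m≤n⇒m<n∨m≡n c≤l
        ... | inj₂ c≡l = i≰z (proj₁ (int (s≤s (<⇒≤ i<c)) ≤-refl z<N ≤-refl (<⇒≤ i<c)
                               (i-min (≰⇒> i≰z)) (subst (λ x → f z < f x) (sym c≡l) fz<fl)))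
        ... | inj₁ c<l = [ just-below , just-above ]′ height
          where
          fi<fz : f i < f z
          fi<fz = i-min (≰⇒> i≰z)
          just-below : u ≢ f q
          just-below u≡ = <⇒≱ fl<u (≤-trans (≤-reflexive u≡) (q-least l<N (c<l , <-trans fi<fz fz<fl)))
          just-above : ¬ (u ≡ suc (f q) × (∀ {t} → t < N → f i < f t → f t < f q → i ≤ t × t ≤ c))
          just-above (u≡ , between) =
            i≰z (proj₁ (between z<N fi<fz (<-≤-trans fz<fl (≤-pred (≤-trans fl<u (≤-reflexive u≡))))))

-- Reaching a simple permutation

module _ (σ π : Perm) where

  -- There are `suc M` entries, so `M` is the last position. `rising` holds for σ ⊕ 1 and provides
  -- an entry above and to the right of each interval to be cut; at the end it also excludes proper
  -- suffixes that start with a left-to-right minimum.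
  record Extension (M : ℕ) (f : ℕ → ℕ) : Set where
    field
      injective : Injective _≡_ _≡_ f
      contains  : Copy σ (suc M) f
      avoids    : ¬ Copy π (suc M) f
      rising    : f 0 < f M

  extension-ins : ∀ {M f p u} → 0 < p → p ≤ M → ¬ Copy π (suc (suc M)) (ins p u f) →
                  Extension M f → Extension (suc M) (ins p u f)
  extension-ins {M} {f} {p} {u} 0<p p≤M avoids′ ext = record
    { injective = ins-injective p u f injective
    ; contains  = copy-old p u f {σ} contains
    ; avoids    = avoids′
    ; rising    = subst₂ (λ x y → ins p u f x < ins p u f y) (up-below 0<p) (up-above p≤M)
                         (old<old p u f rising)
    }
    where open Extension ext

-- Intervals that do not start with a left-to-right minimum contain none, hence
-- Broken 0 M f says that no proper nontrivial interval contains one.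
Broken : ℕ → ℕ → (ℕ → ℕ) → Set
Broken i M f = ∀ {a c} → i ≤ a → LRMin f a → a < c → c < M → ¬ Interval (suc M) f a c

Alternating : ℕ → ℕ → (ℕ → ℕ) → Set
Alternating i M f = ∀ {j} → i ≤ j → j < M → LRMin f j ⊎ LRMin f (suc j)

interval-old-ends : ∀ p u f {N a c} → Interval (suc N) (ins p u f) (up p a) (up p c) → Interval N f a c
interval-old-ends p u f =
  interval-old p u f (up-mono-≤ p) (up-cancel-≤ p) (up-mono-≤ p) (up-cancel-≤ p)

module _ {σ π : Perm} (shape : Shape π) where
  open Extension

  -- The last conjunct measures progress: an interval that starts in J before `c` and takes in the
  -- new entry must end beyond the old last entry of J, now at `suc c`.
  break-interval : ∀ {M f i c} → Extension σ π M f → LRMin f i → i < c → c < M →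
    Interval (suc M) f i c →
    ∃ λ u → Extension σ π (suc M) (ins c u f) × f i < u ×
      (∀ {a c′} → i ≤ a → a < c → c ≤ c′ → Interval (suc (suc M)) (ins c u f) (up c a) c′ →
       suc (suc c) ≤ c′)
  break-interval {M} {f} {i} {c} ext i-min i<c c<M int = choose
    where
    fi<fM : f i < f M
    fi<fM with i ≟ 0
    ... | yes refl = rising ext
    ... | no i≢0   = <-trans (i-min (n≢0⇒n>0 i≢0)) (rising ext)

    lowest : ∃ λ q → q < suc M × (c < q × f i < f q) ×
               (∀ {k} → k < suc M → c < k × f i < f k → f q ≤ f k)
    lowest = argmin f (λ k → (c <? k) ×-dec (f i <? f k)) (suc M) (M , ≤-refl , c<M , fi<fM)

    q : ℕ
    q = proj₁ lowest
    q<N : q < suc M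
    q<N = proj₁ (proj₂ lowest)
    c<q : c < q
    c<q = proj₁ (proj₁ (proj₂ (proj₂ lowest)))
    fi<fq : f i < f q
    fi<fq = proj₂ (proj₁ (proj₂ (proj₂ lowest)))
    q-least : ∀ {k} → k < suc M → c < k × f i < f k → f q ≤ f k
    q-least = proj₂ (proj₂ (proj₂ lowest))

    Outside : ℕ → Set
    Outside t = f i < f t × f t < f q × ¬ (i ≤ t × t ≤ c)

    outside? : Decidable Outside
    outside? t = (f i <? f t) ×-dec (f t <? f q) ×-dec ¬? ((i ≤? t) ×-dec (t ≤? c))

    Height : ℕ → Set
    Height u = u ≡ f q ⊎
               u ≡ suc (f q) × (∀ {t} → t < suc M → f i < f t → f t < f q → i ≤ t × t ≤ c)

    extend : ∀ {u} → Height u → Extension σ π (suc M) (ins c u f)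
    extend height = extension-ins σ π (≤-<-trans z≤n i<c) (<⇒≤ c<M)
      (legal-inner shape (injective ext) (avoids ext) i<c i-min int c<q q<N fi<fq q-least height) ext

    choose : ∃ λ u → Extension σ π (suc M) (ins c u f) × f i < u ×
      (∀ {a c′} → i ≤ a → a < c → c ≤ c′ → Interval (suc (suc M)) (ins c u f) (up c a) c′ →
       suc (suc c) ≤ c′)
    choose with anyUpTo? outside? (suc M)
    -- Right of `c`, the entry `t` would undercut `q`, so it is left of `i`. An interval with `a`
    -- and the new entry would contain `t` by value, although `t < a`.
    ... | yes (t , t<N , fi<ft , ft<fq , t∉J) = f q , extend (inj₁ refl) , fi<fq , reach
      where
      t<i : t < i
      t<i = ≰⇒> λ i≤t → <⇒≱ ft<fq (q-least t<N (≰⇒> (λ t≤c → t∉J (i≤t , t≤c)) , fi<ft))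
      reach : ∀ {a c′} → i ≤ a → a < c → c ≤ c′ →
              Interval (suc (suc M)) (ins c (f q) f) (up c a) c′ → suc (suc c) ≤ c′
      reach {a} {c′} i≤a a<c c≤c′ int′ = contradiction (<-≤-trans t<i i≤a)
        (≤⇒≯ (up-cancel-≤ c (proj₁ (int′ (s≤s (≤-trans up-a≤c c≤c′)) (s≤s c≤c′)
                (up-< c t<N) ≤-refl up-a≤c (old<old c (f q) f fa<ft) (old<new c (f q) f ft<fq)))))
        where
        up-a≤c : up c a ≤ c
        up-a≤c = ≤-trans (≤-reflexive (up-below a<c)) (<⇒≤ a<c)
        fa<ft : f a < f t
        fa<ft = ≰⇒> λ ft≤fa → t∉J (int (s≤s (<⇒≤ i<c)) (s≤s (<⇒≤ a<c)) t<N ≤-refl i≤a fi<ft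
                  (≤∧≢⇒f< (injective ext) ft≤fa (<⇒≢ (<-≤-trans t<i i≤a))))
    -- The new entry is above `q` and `q` is above J, so an interval with `a` and the new entry
    -- contains `q`, now at position `suc q`.
    ... | no none = suc (f q) , extend (inj₂ (refl , between)) , m<n⇒m<1+n fi<fq , reach
      where
      between : ∀ {t} → t < suc M → f i < f t → f t < f q → i ≤ t × t ≤ c
      between {t} t<N fi<ft ft<fq = decidable-stable ((i ≤? t) ×-dec (t ≤? c))
        λ t∉J → none (t , t<N , fi<ft , ft<fq , t∉J)
      reach : ∀ {a c′} → i ≤ a → a < c → c ≤ c′ →
              Interval (suc (suc M)) (ins c (suc (f q)) f) (up c a) c′ → suc (suc c) ≤ c′
      reach {a} {c′} i≤a a<c c≤c′ int′ = ≤-trans (s≤s c<q) (≤-trans (≤-reflexive (sym (up-above (<⇒≤ c<q))))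
        (proj₂ (int′ (s≤s (≤-trans up-a≤c c≤c′)) (s≤s c≤c′) (up-< c q<N) ≤-refl up-a≤c
          (old<old c _ f (inside⇒<fq shape (injective ext) (avoids ext) i<c i-min int c<q q<N fi<fq q-least
            (inj₂ (refl , between)) i≤a (<⇒≤ a<c)))
          (old<new c _ f ≤-refl))))
        where
        up-a≤c : up c a ≤ c
        up-a≤c = ≤-trans (≤-reflexive (up-below a<c)) (<⇒≤ a<c)

  -- Insertions happen to the right of i, so breaking the intervals that start
  -- at i does not shift i; each one lets c gain two places while M gains one.
  break-at : ∀ fuel {M f i c} → fuel + c ≡ M → i < c → Extension σ π M f → LRMin f i →
    Broken (suc i) M f → (∀ {c′} → i < c′ → c′ < c → ¬ Interval (suc M) f i c′) →
    ∃ λ M′ → ∃ λ f′ → Extension σ π M′ f′ × Broken i M′ f′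
  break-at zero {M} {f} {i} refl i<c ext i-min broken short = M , f , ext , broken′
    where
    broken′ : Broken i M f
    broken′ i≤a a-min a<c c<M with m≤n⇒m<n∨m≡n i≤a
    ... | inj₁ i<a  = broken i<a a-min a<c c<M
    ... | inj₂ refl = short a<c c<M
  break-at (suc fuel) {M} {f} {i} {c} fuel+c≡M i<c ext i-min broken short
    with interval? (suc M) f i c
  ... | no ¬int = break-at fuel (trans (+-suc fuel c) fuel+c≡M) (m<n⇒m<1+n i<c) ext i-min broken short′
    where
    short′ : ∀ {c′} → i < c′ → c′ < suc c → ¬ Interval (suc M) f i c′
    short′ i<c′ c′<1+c with m<1+n⇒m<n∨m≡n c′<1+c
    ... | inj₁ c′<c = short i<c′ c′<c
    ... | inj₂ refl = ¬int
  ... | yes int with break-interval ext i-min i<c (≤-trans (s≤s (m≤n+m c fuel)) (≤-reflexive fuel+c≡M)) int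
  ...   | u , ext′ , fi<u , reach =
    break-at fuel (trans (+-suc fuel (suc c)) (cong suc (trans (+-suc fuel c) fuel+c≡M)))
             (m<n⇒m<1+n (m<n⇒m<1+n i<c)) ext′ i-min′ broken′ short′
    where
    f′ : ℕ → ℕ
    f′ = ins c u f

    c≤M : c ≤ M
    c≤M = ≤-trans (m≤n+m c (suc fuel)) (≤-reflexive fuel+c≡M)

    i-min′ : LRMin f′ i
    i-min′ {j} j<i = subst₂ (λ x y → f′ x < f′ y) (up-below i<c) (up-below (<-trans j<i i<c))
                            (old<old c u f (i-min j<i))

    -- The new entry is no left-to-right minimum, since `i` precedes it with a smaller value, and by
    -- `reach` no such interval ends at it. The others restrict to old intervals.
    broken′ : Broken (suc i) (suc M) f′
    broken′ {a} {c′} i<a a-min a<c′ c′<M int′ with view c a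
    ... | new   = <-asym (old<new c u f fi<u)
                    (subst (λ x → f′ c < f′ x) (sym (up-below i<c)) (a-min i<c))
    ... | old a with view c c′
    ...   | new    = <⇒≱ (n<1+n c) (≤-trans (n≤1+n _) (reach (<⇒≤ i<a₀) (up<⇒< a<c′) ≤-refl int′))
      where
      i<a₀ : i < a
      i<a₀ = up-cancel-< c (subst (_< up c a) (sym (up-below i<c)) i<a)
    ...   | old c₀ = broken (up-cancel-< c (subst (_< up c a) (sym (up-below i<c)) i<a))
                       (lrMin-old c u f a-min) (up-cancel-< c a<c′) (up<suc⇒< c≤M c′<M)
                       (interval-old-ends c u f int′)

    short′ : ∀ {c′} → i < c′ → c′ < suc (suc c) → ¬ Interval (suc (suc M)) f′ i c′
    short′ {c′} i<c′ c′<2+c int′ with c ≤? c′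
    ... | yes c≤c′ = <⇒≱ c′<2+c (reach ≤-refl i<c c≤c′
                       (subst (λ x → Interval (suc (suc M)) f′ x c′) (sym (up-below i<c)) int′))
    ... | no c≰c′  = short i<c′ (≰⇒> c≰c′) (interval-old-ends c u f
                       (subst₂ (Interval (suc (suc M)) f′) (sym (up-below i<c))
                               (sym (up-below (≰⇒> c≰c′))) int′))

  -- Starting positions are treated from right to left, as cutting the intervals that start at `i`
  -- leaves all entries up to `i` in place.
  break-all : ∀ i {M f} → Extension σ π M f → Broken i M f →
              ∃ λ M′ → ∃ λ f′ → Extension σ π M′ f′ × Broken 0 M′ f′
  break-all zero ext broken = _ , _ , ext , broken
  break-all (suc i) {M} {f} ext broken with suc i ≤? M | lrMin-dec (injective ext) i
  ... | no 1+i≰M | _ = break-all i ext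
          λ i≤a _ a<c c<M _ → 1+i≰M (≤-trans (s≤s i≤a) (≤-trans a<c (<⇒≤ c<M)))
  ... | yes _ | inj₂ (j , j<i , fj<fi) = break-all i ext broken′
    where
    broken′ : Broken i M f
    broken′ i≤a a-min with m≤n⇒m<n∨m≡n i≤a
    ... | inj₁ i<a  = broken i<a a-min
    ... | inj₂ refl = ⊥-elim (<-asym fj<fi (a-min j<i))
  ... | yes 1+i≤M | inj₁ i-min
    with break-at (M ∸ suc i) (m∸n+n≡m 1+i≤M) ≤-refl ext i-min broken
           (λ i<c′ c′<1+i → ⊥-elim (<⇒≱ i<c′ (≤-pred c′<1+i)))
  ...   | _ , _ , ext′ , broken′ = break-all i ext′ broken′

  -- Separating adjacent entries that are not left-to-right minima

  interleave : ∀ i {M f} → Extension σ π M f → Broken 0 M f → Alternating i M f →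
    ∃ λ M′ → ∃ λ f′ → Extension σ π M′ f′ × Broken 0 M′ f′ × Alternating 0 M′ f′
  interleave zero ext broken alt = _ , _ , ext , broken , alt
  interleave (suc i) {M} {f} ext broken alt with suc i ≤? M
  ... | no 1+i≰M = interleave i ext broken
          λ i≤j j<M → contradiction (≤-trans (s≤s i≤j) j<M) 1+i≰M
  ... | yes p≤M with lrMin-dec (injective ext) i | lrMin-dec (injective ext) (suc i)
  ...   | inj₁ i-min | _ = interleave i ext broken λ i≤j j<M →
            [ (λ i<j → alt i<j j<M) , (λ { refl → inj₁ i-min }) ]′ (m≤n⇒m<n∨m≡n i≤j)
  ...   | inj₂ _ | inj₁ p-min = interleave i ext broken λ i≤j j<M →
            [ (λ i<j → alt i<j j<M) , (λ { refl → inj₂ p-min }) ]′ (m≤n⇒m<n∨m≡n i≤j)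
  ...   | inj₂ (j , j<i , fj<fi) | inj₂ (k , k<p , fk<fp)
    with argmin f {λ _ → ⊤} (λ _ → yes tt) (suc i) (i , ≤-refl , tt)
  ...     | m , m<p , _ , least = interleave i ext′ broken′ alt′
    where
    p : ℕ
    p = suc i

    f′ : ℕ → ℕ
    f′ = ins p (f m) f

    m-least : ∀ {j} → j < p → f m ≤ f j
    m-least j<p = least j<p tt

    ext′ : Extension σ π (suc M) f′
    ext′ = extension-ins σ π z<s p≤M
      (legal-min shape (injective ext) (avoids ext) (m≤n⇒m≤1+n p≤M) m<p m-least) ext

    p-min : LRMin f′ p
    p-min {j} j<p with view p j
    ... | new    = contradiction j<p (<-irrefl refl)
    ... | old j₀ = new<old p (f m) f (m-least (up<⇒< j<p))

    -- Such an entry is already lower than `m`, hence lower than a new entry just below `m`.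
    lrMin-new : ∀ {a} → p ≤ a → LRMin f a → LRMin f′ (up p a)
    lrMin-new p≤a a-min {j} j<a with view p j
    ... | new    = old<new p (f m) f (a-min (<-≤-trans m<p p≤a))
    ... | old j₀ = old<old p (f m) f (a-min (up-cancel-< p j<a))

    broken′ : Broken 0 (suc M) f′
    broken′ {a} {c} _ a-min a<c c<1+M int with view p a
    -- An interval starting at the new entry contains its right neighbour, the old entry `p`. As `k`
    -- shows that `p` is above the prefix minimum, `m` lies between the two in value.
    ... | new = <⇒≱ m<p (subst (p ≤_) (up-below m<p)
            (proj₁ (int (s≤s (<⇒≤ a<c)) (s≤s (subst (_≤ c) (sym (up-above ≤-refl)) a<c))
              (up-< p (m<n⇒m<1+n (<-≤-trans m<p p≤M)))
              ≤-refl (subst (p ≤_) (sym (up-above ≤-refl)) (n≤1+n p))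
              (new<old p (f m) f ≤-refl) (old<old p (f m) f (≤-<-trans (m-least k<p) fk<fp)))))
    ... | old a with view p c
    ...   | old c₀ = broken z≤n (lrMin-old p (f m) f a-min) (up-cancel-< p a<c)
                       (up<suc⇒< p≤M c<1+M) (interval-old-ends p (f m) f int)
    -- Without the new entry at its right end, the interval is an old one ending at `i`, or just
    -- `i`, which is no left-to-right minimum because of `j`.
    ...   | new with m<1+n⇒m<n∨m≡n (up<⇒< a<c)
    ...     | inj₁ a<i  = broken z≤n (lrMin-old p (f m) f a-min) a<i p≤M
                (interval-old p (f m) f (up-mono-≤ p) (up-cancel-≤ p)
                  (λ {j} j≤i → ≤-trans (≤-reflexive (up-below (s≤s j≤i))) (m≤n⇒m≤1+n j≤i))
                  (λ le → ≤-pred (up≤⇒< le)) int)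
    ...     | inj₂ refl = <-asym fj<fi (lrMin-old p (f m) f a-min j<i)

    alt′ : Alternating i (suc M) f′
    alt′ {j} i≤j j<1+M with view p j
    ... | new = inj₁ p-min
    ... | old j₀ with j₀ <? p
    ...   | yes j₀<p = inj₂ (subst (LRMin f′ ∘ suc)
              (≤-antisym i≤j (≤-trans (≤-reflexive (up-below j₀<p)) (≤-pred j₀<p))) p-min)
    ...   | no j₀≮p with alt (≮⇒≥ j₀≮p) (up<suc⇒< p≤M j<1+M)
    ...     | inj₁ j₀-min  = inj₁ (lrMin-new (≮⇒≥ j₀≮p) j₀-min)
    ...     | inj₂ 1+j₀-min = inj₂ (subst (LRMin f′)
                (trans (up-above (m≤n⇒m≤1+n (≮⇒≥ j₀≮p))) (cong suc (sym (up-above (≮⇒≥ j₀≮p)))))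
                (lrMin-new (m≤n⇒m≤1+n (≮⇒≥ j₀≮p)) 1+j₀-min))

  -- Both passes start at the last position, where their hypotheses hold vacuously.
  simple-extension : ∀ {M f} → Extension σ π M f →
    ∃ λ M′ → ∃ λ f′ → Extension σ π M′ f′ ×
      (∀ {a c} → a ≤ c → c ≤ M′ → Interval (suc M′) f′ a c → a ≡ c ⊎ a ≡ 0 × c ≡ M′)
  simple-extension {M} ext
    with break-all M ext (λ M≤a _ a<c c<M _ → <⇒≱ (<-trans a<c c<M) M≤a)
  ... | M₁ , _ , ext₁ , broken₁
    with interleave M₁ ext₁ broken₁ (λ M≤j j<M → ⊥-elim (<⇒≱ j<M M≤j))
  ... | M₂ , f₂ , ext₂ , broken , alt = M₂ , f₂ , ext₂ , simple
    where
    simple : ∀ {a c} → a ≤ c → c ≤ M₂ → Interval (suc M₂) f₂ a c → a ≡ c ⊎ a ≡ 0 × c ≡ M₂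
    simple {a} {c} a≤c c≤M int with m≤n⇒m<n∨m≡n a≤c
    ... | inj₂ a≡c = inj₁ a≡c
    ... | inj₁ a<c with lrMin-dec (injective ext₂) a | m≤n⇒m<n∨m≡n c≤M
    ...   | inj₁ a-min | inj₁ c<M = ⊥-elim (broken z≤n a-min a<c c<M int)
    -- A suffix with `a` positive has `f a < f 0 < f M`, so it would contain position 0.
    ...   | inj₁ a-min | inj₂ refl with a ≟ 0
    ...     | yes a≡0 = inj₂ (a≡0 , refl)
    ...     | no a≢0  = ⊥-elim (a≢0 (n≤0⇒n≡0 (proj₁
                (int (s≤s a≤c) ≤-refl z<s ≤-refl a≤c (a-min (n≢0⇒n>0 a≢0)) (rising ext₂)))))
    -- Since `a` is no left-to-right minimum, `suc a` is one; the values of the two enclose that of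
    -- `j`, although `j < a`.
    simple {a} {c} a≤c c≤M int | inj₁ a<c | inj₂ (j , j<a , fj<fa) | _
      with alt z≤n (<-≤-trans a<c c≤M)
    ... | inj₁ a-min   = ⊥-elim (<-asym fj<fa (a-min j<a))
    ... | inj₂ 1+a-min = ⊥-elim (<⇒≱ j<a (proj₁
            (int (s≤s a<c) (s≤s a≤c) (s≤s (≤-trans (<⇒≤ j<a) (≤-trans a≤c c≤M)))
                 (n≤1+n a) ≤-refl (1+a-min (m<n⇒m<1+n j<a)) fj<fa)))

-- Back to permutations

copy⇒≼ : ∀ α β f → (∀ {i j} → f (toℕ i) < f (toℕ j) → toℕ (fun β i) < toℕ (fun β j)) →
         Copy α (len β) f → α ≼ β
copy⇒≼ α β f β-ord (e , e< , e-mono , e-ord) = e′ , mono , λ i j → mk⇔ (ord i j) (ord⁻ i j)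
  where
  e′ : Fin (len α) → Fin (len β)
  e′ i = fromℕ< (e< i)
  toℕ-e′ : ∀ i → toℕ (e′ i) ≡ e i
  toℕ-e′ i = toℕ-fromℕ< (e< i)
  mono : ∀ i j → toℕ i < toℕ j → toℕ (e′ i) < toℕ (e′ j)
  mono i j lt = subst₂ _<_ (sym (toℕ-e′ i)) (sym (toℕ-e′ j)) (e-mono i j lt)
  ord : ∀ i j → toℕ (fun α i) < toℕ (fun α j) → toℕ (fun β (e′ i)) < toℕ (fun β (e′ j))
  ord i j lt = β-ord (subst₂ (λ x y → f x < f y) (sym (toℕ-e′ i)) (sym (toℕ-e′ j)) (e-ord i j lt))
  ord⁻ : ∀ i j → toℕ (fun β (e′ i)) < toℕ (fun β (e′ j)) → toℕ (fun α i) < toℕ (fun α j)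
  ord⁻ i j lt with <-cmp (toℕ (fun α i)) (toℕ (fun α j))
  ... | tri< αi<αj _ _ = αi<αj
  ... | tri≈ _ αi≡αj _ = contradiction lt
          (<-irrefl (cong (toℕ ∘ fun β ∘ e′) (inj α i j (toℕ-injective αi≡αj))))
  ... | tri> _ _ αj<αi = contradiction lt (<-asym (ord j i αj<αi))

-- Standardization of an injective sequence

count : (ℕ → ℕ) → ℕ → ℕ → ℕ
count f y zero = zero
count f y (suc N) with f N <? y
... | yes _ = suc (count f y N)
... | no _  = count f y N

module _ (f : ℕ → ℕ) where

  count-≤ : ∀ y N → count f y N ≤ N
  count-≤ y zero = z≤n
  count-≤ y (suc N) with f N <? y
  ... | yes _ = s≤s (count-≤ y N)
  ... | no _  = m≤n⇒m≤1+n (count-≤ y N)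

  count-mono-≤ : ∀ {y z} N → y ≤ z → count f y N ≤ count f z N
  count-mono-≤ zero _ = z≤n
  count-mono-≤ {y} {z} (suc N) y≤z with f N <? y | f N <? z
  ... | yes _    | yes _    = s≤s (count-mono-≤ N y≤z)
  ... | yes fN<y | no fN≮z  = contradiction (<-≤-trans fN<y y≤z) fN≮z
  ... | no _     | yes _    = m≤n⇒m≤1+n (count-mono-≤ N y≤z)
  ... | no _     | no _     = count-mono-≤ N y≤z

  count-mono-< : ∀ {y z j N} → j < N → y ≤ f j → f j < z → count f y N < count f z N
  count-mono-< {y} {z} {j} {suc N} j<1+N y≤fj fj<z with f N <? y | f N <? z | m<1+n⇒m<n∨m≡n j<1+N
  ... | yes _    | yes _    | inj₁ j<N  = s≤s (count-mono-< j<N y≤fj fj<z)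
  ... | yes fN<y | no fN≮z  | _         =
    contradiction (<-≤-trans fN<y (≤-trans y≤fj (<⇒≤ fj<z))) fN≮z
  ... | no _     | yes _    | _         = s≤s (count-mono-≤ N (≤-trans y≤fj (<⇒≤ fj<z)))
  ... | no _     | no _     | inj₁ j<N  = count-mono-< j<N y≤fj fj<z
  ... | yes fN<y | _        | inj₂ refl = contradiction fN<y (≤⇒≯ y≤fj)
  ... | _        | no fN≮z  | inj₂ refl = contradiction fj<z fN≮z

  count-< : ∀ {y j N} → j < N → y ≤ f j → count f y N < N
  count-< {N = N} j<N y≤fj = <-≤-trans (count-mono-< j<N y≤fj ≤-refl) (count-≤ _ N)

module _ (N : ℕ) (f : ℕ → ℕ) (f-inj : Injective _≡_ _≡_ f) where

  rank : Fin N → Fin N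
  rank i = fromℕ< (count-< f (toℕ<n i) ≤-refl)

  toℕ-rank : ∀ i → toℕ (rank i) ≡ count f (f (toℕ i)) N
  toℕ-rank i = toℕ-fromℕ< (count-< f (toℕ<n i) ≤-refl)

  rank-mono : ∀ {i j} → f (toℕ i) < f (toℕ j) → toℕ (rank i) < toℕ (rank j)
  rank-mono {i} {j} lt = subst₂ _<_ (sym (toℕ-rank i)) (sym (toℕ-rank j))
    (count-mono-< f (toℕ<n i) ≤-refl lt)

  rank-cancel : ∀ {i j} → toℕ (rank i) < toℕ (rank j) → f (toℕ i) < f (toℕ j)
  rank-cancel {i} {j} lt with <-cmp (f (toℕ i)) (f (toℕ j))
  ... | tri< fi<fj _ _ = fi<fj
  ... | tri≈ _ fi≡fj _ = contradiction lt (<-irrefl (cong (toℕ ∘ rank) (toℕ-injective (f-inj fi≡fj))))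
  ... | tri> _ _ fj<fi = contradiction lt (<-asym (rank-mono fj<fi))

  rank-injective : ∀ i j → rank i ≡ rank j → i ≡ j
  rank-injective i j eq with <-cmp (f (toℕ i)) (f (toℕ j))
  ... | tri< fi<fj _ _ = contradiction (cong toℕ eq) (<⇒≢ (rank-mono fi<fj))
  ... | tri≈ _ fi≡fj _ = toℕ-injective (f-inj fi≡fj)
  ... | tri> _ _ fj<fi = contradiction (cong toℕ eq) (>⇒≢ (rank-mono fj<fi))

  standardize : Perm
  standardize = perm N rank rank-injective

  ≼⇒copy : ∀ {α} → α ≼ standardize → Copy α N f
  ≼⇒copy (e , e-mono , e-ord) =
    toℕ ∘ e , toℕ<n ∘ e , e-mono , λ i j lt → rank-cancel (Equivalence.to (e-ord i j) lt)

  interval-standardize : ∀ {a c} → IsIntervalSeg standardize a c → Interval N f a c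
  interval-standardize {a} {c} (_ , c<N , seg) {i} i≤c {j} j≤c {k} k<N a≤i a≤j fi<fk fk<fj =
    subst (λ x → a ≤ x × x ≤ c) (toℕ-fromℕ< k<N)
      (seg i′ j′ k′ (at-pos i<N a≤i) (at-pos′ i<N (≤-pred i≤c)) (at-pos j<N a≤j) (at-pos′ j<N (≤-pred j≤c))
        (<⇒≤ (rank-mono (ord i<N k<N fi<fk))) (<⇒≤ (rank-mono (ord k<N j<N fk<fj))))
    where
    i<N : i < N
    i<N = <-≤-trans i≤c c<N
    j<N : j < N
    j<N = <-≤-trans j≤c c<N
    i′ j′ k′ : Fin N
    i′ = fromℕ< i<N
    j′ = fromℕ< j<N
    k′ = fromℕ< k<N
    at-pos : ∀ {x} (x<N : x < N) → a ≤ x → a ≤ toℕ (fromℕ< x<N)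
    at-pos x<N = subst (a ≤_) (sym (toℕ-fromℕ< x<N))
    at-pos′ : ∀ {x} (x<N : x < N) → x ≤ c → toℕ (fromℕ< x<N) ≤ c
    at-pos′ x<N = subst (_≤ c) (sym (toℕ-fromℕ< x<N))
    ord : ∀ {x y} (x<N : x < N) (y<N : y < N) → f x < f y →
          f (toℕ (fromℕ< x<N)) < f (toℕ (fromℕ< y<N))
    ord x<N y<N = subst₂ (λ x y → f x < f y) (sym (toℕ-fromℕ< x<N)) (sym (toℕ-fromℕ< y<N))

-- The starting sequence and the conclusion

-- The first suc (len σ) entries form σ followed by a new maximum.
entries : Perm → ℕ → ℕ
entries σ j with j <? len σ
... | yes j<n = toℕ (fun σ (fromℕ< j<n))
... | no _    = j

entries-fin : ∀ σ i → entries σ (toℕ i) ≡ toℕ (fun σ i)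
entries-fin σ i with toℕ i <? len σ
... | yes i<n = cong (toℕ ∘ fun σ) (fromℕ<-toℕ i i<n)
... | no i≮n  = contradiction (toℕ<n i) i≮n

entries-beyond : ∀ σ {j} → len σ ≤ j → entries σ j ≡ j
entries-beyond σ {j} n≤j with j <? len σ
... | yes j<n = contradiction j<n (≤⇒≯ n≤j)
... | no _    = refl

entries-< : ∀ σ {j} → j < len σ → entries σ j < len σ
entries-< σ {j} j<n with j <? len σ
... | yes p  = toℕ<n (fun σ (fromℕ< p))
... | no j≮n = contradiction j<n j≮n

entries-injective : ∀ σ → Injective _≡_ _≡_ (entries σ)
entries-injective σ {i} {j} eq with i <? len σ | j <? len σ
... | yes i<n | yes j<n = Fin.fromℕ<-injective i j i<n j<n (inj σ _ _ (toℕ-injective eq))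
... | yes i<n | no j≮n  = contradiction (subst (_< len σ) eq (toℕ<n _)) j≮n
... | no i≮n  | yes j<n = contradiction (subst (_< len σ) (sym eq) (toℕ<n _)) i≮n
... | no _    | no _    = eq

at-suc : ∀ σ i → at σ (suc (toℕ i)) ≡ suc (toℕ (fun σ i))
at-suc σ i with toℕ i <? len σ
... | yes i<n = cong (suc ∘ toℕ ∘ fun σ) (fromℕ<-toℕ i i<n)
... | no i≮n  = contradiction (toℕ<n i) i≮n

shape-1⊕ : ∀ ρ → 4 ≤ len (1⊕ ρ) → at (1⊕ ρ) 2 ≡ len (1⊕ ρ) → at (1⊕ ρ) (len (1⊕ ρ)) ≡ 2 →
           Shape (1⊕ ρ)
shape-1⊕ (perm (suc zero) _ _) (s≤s (s≤s ()))
shape-1⊕ (perm (suc (suc zero)) _ _) (s≤s (s≤s (s≤s ())))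
shape-1⊕ ρ@(perm (suc (suc (suc r))) g g-inj) (s≤s _) at-second at-last = record
  { first = zero
  ; second = suc zero
  ; third = suc (suc zero)
  ; last = last
  ; first< = λ { {zero} i≢ → contradiction refl i≢ ; {suc i} _ → z<s }
  ; second< = λ { {zero} i≢ _ → contradiction refl i≢
                ; {suc zero} _ i≢ → contradiction refl i≢
                ; {suc (suc i)} _ _ → s≤s z<s }
  ; second<third = s≤s z<s
  ; third<last = s≤s (s≤s z<s)
  ; <last = λ {i} i≢last → ≤∧≢⇒< (Fin.≤fromℕ i) (i≢last ∘ toℕ-injective)
  ; first-least = λ { {zero} i≢ → contradiction refl i≢ ; {suc i} _ → z<s }
  ; second-max = λ {i} i≢second → ≤∧≢⇒<
      (≤-trans (≤-pred (toℕ<n (fun π i))) (≤-reflexive (sym second-value)))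
      λ eq → i≢second (inj π i (suc zero) (toℕ-injective eq))
  ; last-next = λ { {zero} i≢ _ → contradiction refl i≢
                  ; {suc i} _ i≢last → ≤∧≢⇒< (≤-trans (≤-reflexive last-value) (s≤s z≤n))
                      λ eq → i≢last (inj π (suc i) last (toℕ-injective (sym eq))) }
  }
  where
  π : Perm
  π = 1⊕ ρ
  last : Fin (len π)
  last = fromℕ (suc (suc (suc r)))
  second-value : toℕ (fun π (suc zero)) ≡ suc (suc (suc r))
  second-value = suc-injective (trans (sym (at-suc π (suc zero))) at-second)
  last-value : toℕ (fun π last) ≡ 1
  last-value = suc-injective
    (trans (sym (at-suc π last)) (trans (cong (at π ∘ suc) (toℕ-fromℕ _)) at-last))

module _ {π : Perm} (shape : Shape π) where
  open Shape shape

  start : ∀ σ → 0 < len σ → Av π σ → Extension σ π (len σ) (entries σ)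
  start σ 0<n π⋠σ = record
    { injective = entries-injective σ
    ; contains  = toℕ , (λ i → m<n⇒m<1+n (toℕ<n i)) , (λ _ _ lt → lt) ,
                  λ i j lt → subst₂ _<_ (sym (entries-fin σ i)) (sym (entries-fin σ j)) lt
    ; avoids    = avoids
    ; rising    = subst (entries σ 0 <_) (sym (entries-beyond σ ≤-refl)) (entries-< σ 0<n)
    }
    where
    -- The last entry of π is not its maximum, so it misses the new maximum.
    avoids : ¬ Copy π (suc (len σ)) (entries σ)
    avoids (e , e< , e-mono , e-ord) = π⋠σ (copy⇒≼ π σ (entries σ) σ-ord (e , e<n , e-mono , e-ord))
      where
      second<last : toℕ second < toℕ last
      second<last = <-trans second<third third<last
      last-value< : entries σ (e last) < entries σ (e second)
      last-value< = e-ord last second (second-max λ { refl → <-irrefl refl second<last })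
      e-last< : e last < len σ
      e-last< with m<1+n⇒m<n∨m≡n (e< last)
      ... | inj₁ lt = lt
      ... | inj₂ eq = contradiction last-value< (<-asym
              (subst (entries σ (e second) <_) (sym (trans (cong (entries σ) eq) (entries-beyond σ ≤-refl)))
                (entries-< σ (subst (e second <_) eq (e-mono second last second<last)))))
      e<n : ∀ i → e i < len σ
      e<n i with i Fin.≟ last
      ... | yes refl  = e-last<
      ... | no i≢last = <-trans (e-mono i last (<last i≢last)) e-last<
      σ-ord : ∀ {i j} → entries σ (toℕ i) < entries σ (toℕ j) → toℕ (fun σ i) < toℕ (fun σ j)
      σ-ord {i} {j} = subst₂ _<_ (entries-fin σ i) (entries-fin σ j)

  simple-above : ∀ σ → Av π σ → ∃ λ τ → IsSimple τ × Av π τ × σ ≼ τ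
  -- The empty permutation is simple itself; followed by a new maximum it would have a single entry
  -- and not satisfy `rising`.
  simple-above σ@(perm zero _ _) π⋠σ = σ , (λ { _ _ (_ , () , _) }) , π⋠σ , (λ ()) , (λ ()) , λ ()
  simple-above σ@(perm (suc _) _ _) π⋠σ with simple-extension shape (start σ z<s π⋠σ)
  ... | M , f , ext , simple =
    standardize (suc M) f injective ,
    (λ a c seg@(a≤c , c<N , _) → Sum.map₂ (Product.map₂ (cong suc))
      (simple a≤c (≤-pred c<N) (interval-standardize (suc M) f injective seg))) ,
    avoids ∘ ≼⇒copy (suc M) f injective {π} ,
    copy⇒≼ σ (standardize (suc M) f injective) f (rank-mono (suc M) f injective) contains
    where open Extension ext

≼-refl : ∀ σ → σ ≼ σ
≼-refl σ = (λ i → i) , (λ _ _ lt → lt) , λ _ _ → mk⇔ (λ lt → lt) (λ lt → lt)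

theorem3p5 : (ρ : Perm) → 4 ≤ len (1⊕ ρ) →
    at (1⊕ ρ) 2 ≡ len (1⊕ ρ) → at (1⊕ ρ) (len (1⊕ ρ)) ≡ 2 →
    ¬ HasIncreasingBond ρ →
    ¬ Deflatable (Av (1⊕ ρ))
theorem3p5 ρ 4≤n at-second at-last _ (D , D-class , _ , (σ , π⋠σ , σ∉D) , Av⊆⟨D⟩)
  with simple-above (shape-1⊕ ρ 4≤n at-second at-last) σ π⋠σ
-- As `τ` is simple and contained in itself, its membership in ⟨D⟩ gives `D τ`, and `D` is closed
-- downwards.
... | τ , τ-simple , π⋠τ , σ≼τ = σ∉D (D-class σ τ σ≼τ (Av⊆⟨D⟩ τ π⋠τ τ τ-simple (≼-refl τ)))
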